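{- For every positive integer $k$ there exists $n_0$ such that for all $n\ge n_0$, $$\mathrm{exa}_k(n,K_3)=\left\lfloor \frac{(n-1)^2}{4}\right\rfloor+k+1.$$
   Context: For a graph $H$ and a graph $F$, $\mathcal N(H,F)$ denotes the number of subgraphs of $H$ isomorphic to $F$. For a nonnegative integer $k$, $\mathrm{exa}_k(n,F)$ is the largest number of edges of a simple graph $H$ on $n$ vertices with $\mathcal N(H,F)=k$. $K_3$ is the triangle. -}

module Defs where

open import Data.Bool using (Bool; true; false; not; _∧_)
open import Data.Fin using (Fin; _≟_; _<?_)
open import Data.Fin.Subset using (Subset; _∈_)
open import Data.List using (List; allFin; cartesianProduct; filterᵇ; length)
open import Data.Nat using (ℕ; _≤_)
open import Data.Product using (Σ; ∃; _×_; _,_; proj₁)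
open import Function.Bundles using (Inverse)
open import Function.Definitions using (Injective)
open import Level using (0ℓ)
open import Relation.Binary.Bundles using (Setoid)
open import Relation.Binary.PropositionalEquality
  using (_≡_; refl; sym; trans; setoid)
open import Relation.Nullary.Decidable using (⌊_⌋; yes; no)
open import Relation.Nullary.Negation using (contradiction)

record Graph (n : ℕ) : Set where
  field
    adj        : Fin n → Fin n → Bool
    adj-sym    : ∀ i j → adj i j ≡ adj j i
    adj-irrefl : ∀ i → adj i i ≡ false

open Graph public

-- Each edge {i , j} is listed once, as the pair with i < j.
edges : ∀ {n} → Graph n → List (Fin n × Fin n)
edges {n} H =
  filterᵇ (λ (i , j) → ⌊ i <? j ⌋ ∧ adj H i j) (cartesianProduct (allFin n) (allFin n))

numEdges : ∀ {n} → Graph n → ℕ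
numEdges H = length (edges H)

complete : ∀ m → Graph m
complete m = record { adj = a ; adj-sym = a-sym ; adj-irrefl = a-irrefl }
  where
  a : Fin m → Fin m → Bool
  a i j = not ⌊ i ≟ j ⌋

  a-sym : ∀ i j → a i j ≡ a j i
  a-sym i j with i ≟ j | j ≟ i
  ... | yes _ | yes _ = refl
  ... | no _  | no _  = refl
  ... | yes p | no ¬p = contradiction (sym p) ¬p
  ... | no ¬p | yes p = contradiction (sym p) ¬p

  a-irrefl : ∀ i → a i i ≡ false
  a-irrefl i with i ≟ i
  ... | yes _ = refl
  ... | no ¬p = contradiction refl ¬p

-- Subgraphs need be neither induced nor spanning.
record Subgraph {n} (H : Graph n) : Set where
  field
    verts    : Subset n
    edge     : Fin n → Fin n → Bool
    edge-sym : ∀ i j → edge i j ≡ edge j i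
    edge⊆adj : ∀ i j → edge i j ≡ true → adj H i j ≡ true
    edge-end : ∀ i j → edge i j ≡ true → i ∈ verts

open Subgraph public

-- Two subgraphs are the same when their vertex sets and their edge sets agree.
_≈ₛ_ : ∀ {n} {H : Graph n} → Subgraph H → Subgraph H → Set
S ≈ₛ T = verts S ≡ verts T × (∀ i j → edge S i j ≡ edge T i j)

record _≅_ {m n} (F : Graph m) {H : Graph n} (S : Subgraph H) : Set where
  field
    to         : Fin m → Fin n
    injective  : Injective _≡_ _≡_ to
    into       : ∀ a → to a ∈ verts S
    onto       : ∀ v → v ∈ verts S → ∃ λ a → to a ≡ v
    preserves  : ∀ a b → edge S (to a) (to b) ≡ adj F a b

-- The set of subgraphs of H isomorphic to F.  The equality ignores the chosen
-- isomorphism, so a subgraph is counted once however many isomorphisms it has.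
Copies : ∀ {n m} → Graph n → Graph m → Setoid 0ℓ 0ℓ
Copies H F = record
  { Carrier = Σ (Subgraph H) (F ≅_)
  ; _≈_     = λ S T → proj₁ S ≈ₛ proj₁ T
  ; isEquivalence = record
    { refl  = refl , λ _ _ → refl
    ; sym   = λ (p , q) → sym p , λ i j → sym (q i j)
    ; trans = λ (p , q) (p′ , q′) → trans p p′ , λ i j → trans (q i j) (q′ i j)
    }
  }

-- 𝒩(H , F) = k
𝒩[_,_]≔_ : ∀ {n m} → Graph n → Graph m → ℕ → Set
𝒩[ H , F ]≔ k = Inverse (setoid (Fin k)) (Copies H F)

-- exa_k(n , F) = e: the maximum is attained and is an upper bound.
exa[_]⟨_,_⟩≔_ : ∀ {m} → ℕ → ℕ → Graph m → ℕ → Set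
exa[ k ]⟨ n , F ⟩≔ e =
  (Σ (Graph n) λ H → 𝒩[ H , F ]≔ k × numEdges H ≡ e) ×
  (∀ (H : Graph n) → 𝒩[ H , F ]≔ k → numEdges H ≤ e)

{-# OPTIONS --safe #-}
module Submission where

-- Upper bound: let T be one triangle of H.  Each of the other k − 1 triangles has a vertex
-- outside T, hence an edge outside T; deleting one such edge per triangle leaves T as the only
-- triangle.  Then the l = n − 3 vertices outside T send at most one edge each to T and, by
-- Mantel's theorem, span at most ⌊l²/4⌋ edges, so at most ⌊l²/4⌋ + l + 3 = ⌊(n−1)²/4⌋ + 2
-- edges survive the deletion.
-- Lower bound: add to a balanced complete bipartite graph on n − 1 vertices a vertex adjacent
-- to one vertex of one part and to k vertices of the other.

open import Data.Bool using (Bool; true; false; not; _∧_; _∨_; if_then_else_; _xor_)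
open import Data.Bool.Properties using (⇔→≡; T-≡; xor-same; xor-comm)
open import Data.Empty using (⊥)
open import Data.Fin using (Fin; zero; suc; toℕ; fromℕ<; inject≤; _≟_; _<?_)
  renaming (_<_ to _<ᶠ_)
open import Data.Fin.Properties using (any?; ¬Fin0; suc-injective; toℕ-inject≤; inject≤-injective; toℕ<n; toℕ-injective; toℕ-fromℕ<)
  renaming (<-irrefl to <ᶠ-irrefl; <-asym to <ᶠ-asym)
open import Data.Fin.Subset using (Subset; _∈_; _∉_; _⊆_)
open import Data.Fin.Subset.Properties using (_∈?_; ⊆-antisym)
open import Data.List using (List; []; _∷_; allFin; cartesianProduct; filterᵇ; length; map; _++_; tabulate)
open import Data.List.Properties using (length-tabulate)
open import Data.List.Membership.Propositional using () renaming (_∈_ to _∈ₗ_)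
open import Data.List.Membership.Propositional.Properties using (∈-∃++; ∈-allFin; ∈-tabulate⁺; ∈-tabulate⁻)
open import Data.List.Relation.Binary.Permutation.Propositional
  using (_↭_; refl; prep; swap; ↭-refl; ↭-sym; ↭-trans; ↭⇒↭ₛ)
open import Data.List.Relation.Binary.Permutation.Propositional.Properties
  using (∈-resp-↭; ↭-length; shift)
import Data.List.Relation.Binary.Permutation.Setoid.Properties as ↭ₛ
import Data.List.Relation.Unary.All as All
open import Data.List.Relation.Unary.AllPairs using (AllPairs; []; _∷_)
import Data.List.Relation.Unary.AllPairs.Properties as AllPairs
open import Data.List.Relation.Unary.Any using (here; there)
open import Data.List.Relation.Unary.Unique.Propositional using (Unique)
open import Data.List.Relation.Unary.Unique.Propositional.Properties using (allFin⁺; cartesianProduct⁺)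
open import Data.Nat using (ℕ; zero; suc; _+_; _*_; _∸_; _^_; _/_; _≤_; _<_; _>_; _<ᵇ_; z≤n; s≤s; s≤s⁻¹; ⌊_/2⌋; ⌈_/2⌉)
open import Data.Nat.Divisibility using (divides)
open import Data.Nat.DivMod using (+-distrib-/-∣ˡ; m*n/n≡m)
open import Data.Nat.Properties hiding (_≟_; _<?_; suc-injective)
open import Data.Nat.Tactic.RingSolver using (solve-∀)
open import Data.Product using (Σ; ∃; ∃₂; _×_; _,_; proj₁; proj₂)
open import Data.Sum using (_⊎_; inj₁; inj₂; [_,_]′)
open import Data.Vec using () renaming (tabulate to tabulateᵛ)
open import Data.Vec.Properties using (lookup∘tabulate; lookup⇒[]=; []=⇒lookup)
open import Function using (_∘_; _⇔_; mk⇔; case_of_)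
open import Function.Bundles using (Inverse; Equivalence)
open import Function.Properties.Bijection using (Bijection⇒Inverse)
open import Relation.Binary.PropositionalEquality
  using (_≡_; _≢_; refl; sym; trans; cong; cong₂; subst; subst₂; setoid; module ≡-Reasoning)
open import Relation.Nullary using (¬_; Dec; yes; no; contradiction)
open import Relation.Nullary.Decidable using (⌊_⌋; decidable-stable; ¬?; _×-dec_; _⊎-dec_)
open import Defs

private
  variable
    A B : Set
    n m : ℕ

-- Passing between decisions and Booleans.

⌊⌋-true : (d : Dec A) → A → ⌊ d ⌋ ≡ true
⌊⌋-true (yes _) _ = refl
⌊⌋-true (no ¬a) a = contradiction a ¬a

⌊⌋-false : (d : Dec A) → ¬ A → ⌊ d ⌋ ≡ false
⌊⌋-false (yes a) ¬a = contradiction a ¬a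
⌊⌋-false (no _)  _  = refl

⌊⌋-true⁻ : (d : Dec A) → ⌊ d ⌋ ≡ true → A
⌊⌋-true⁻ (yes a) _ = a

∧-true⁻ : ∀ {x y} → x ∧ y ≡ true → x ≡ true × y ≡ true
∧-true⁻ {true} {true} _ = refl , refl

∧-true⁺ : ∀ {x y} → x ≡ true → y ≡ true → x ∧ y ≡ true
∧-true⁺ refl refl = refl

true≢false : ∀ {x} → x ≡ true → x ≡ false → A
true≢false refl ()

-- Counting in lists

bit : Bool → ℕ
bit b = if b then 1 else 0

bit≤1 : ∀ b → bit b ≤ 1
bit≤1 true  = ≤-refl
bit≤1 false = z≤n

count : (A → Bool) → List A → ℕ
count p []       = 0
count p (x ∷ xs) = bit (p x) + count p xs

length-filterᵇ : ∀ (p : A → Bool) xs → length (filterᵇ p xs) ≡ count p xs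
length-filterᵇ p []       = refl
length-filterᵇ p (x ∷ xs) with p x
... | true  = cong suc (length-filterᵇ p xs)
... | false = length-filterᵇ p xs

count-++ : ∀ (p : A → Bool) xs ys → count p (xs ++ ys) ≡ count p xs + count p ys
count-++ p []       ys = refl
count-++ p (x ∷ xs) ys = trans (cong (bit (p x) +_) (count-++ p xs ys)) (sym (+-assoc (bit (p x)) _ _))

count-map : ∀ (p : B → Bool) (f : A → B) xs → count p (map f xs) ≡ count (p ∘ f) xs
count-map p f []       = refl
count-map p f (x ∷ xs) = cong (bit (p (f x)) +_) (count-map p f xs)

count-tabulate : ∀ (p : A → Bool) (f : Fin n → A) → count p (tabulate f) ≡ count (p ∘ f) (allFin n)
count-tabulate {n = zero}  p f = refl
count-tabulate {n = suc n} p f = cong (bit (p (f zero)) +_)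
  (trans (count-tabulate p (f ∘ suc)) (sym (count-tabulate (p ∘ f) suc)))

count-cong : ∀ {p q : A → Bool} xs → (∀ {x} → x ∈ₗ xs → p x ≡ q x) → count p xs ≡ count q xs
count-cong []       p≡q = refl
count-cong (x ∷ xs) p≡q = cong₂ _+_ (cong bit (p≡q (here refl))) (count-cong xs (p≡q ∘ there))

count-none : ∀ {p : A → Bool} xs → (∀ {x} → x ∈ₗ xs → p x ≡ false) → count p xs ≡ 0
count-none []       none = refl
count-none (x ∷ xs) none = cong₂ _+_ (cong bit (none (here refl))) (count-none xs (none ∘ there))

count≤length : ∀ (p : A → Bool) xs → count p xs ≤ length xs
count≤length p []       = z≤n
count≤length p (x ∷ xs) = +-mono-≤ (bit≤1 (p x)) (count≤length p xs)

count-mono : ∀ {p q : A → Bool} → (∀ x → p x ≡ true → q x ≡ true) → ∀ xs → count p xs ≤ count q xs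
count-mono         p⇒q []       = z≤n
count-mono {p = p} p⇒q (x ∷ xs) with p x in px
... | false = ≤-trans (count-mono p⇒q xs) (m≤n+m _ _)
... | true rewrite p⇒q x px = s≤s (count-mono p⇒q xs)

bit-∨ : ∀ x y → bit (x ∨ y) ≤ bit x + bit y
bit-∨ true  y = s≤s z≤n
bit-∨ false y = ≤-refl

bit-disjoint : ∀ x y → (x ≡ true → ¬ y ≡ true) → bit x + bit y ≤ bit (x ∨ y)
bit-disjoint true  true  disj = contradiction refl (disj refl)
bit-disjoint true  false disj = ≤-refl
bit-disjoint false y     disj = ≤-refl

+-interchange : ∀ a b c d → (a + b) + (c + d) ≡ (a + c) + (b + d)
+-interchange = solve-∀

count-∨ : ∀ (p q : A → Bool) xs → count (λ x → p x ∨ q x) xs ≤ count p xs + count q xs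
count-∨ p q []       = z≤n
count-∨ p q (x ∷ xs) = ≤-trans (+-mono-≤ (bit-∨ (p x) (q x)) (count-∨ p q xs))
  (≤-reflexive (+-interchange (bit (p x)) (bit (q x)) _ _))

count-disjoint : ∀ (p q : A → Bool) xs → (∀ {x} → x ∈ₗ xs → p x ≡ true → ¬ q x ≡ true) →
                 count p xs + count q xs ≤ count (λ x → p x ∨ q x) xs
count-disjoint p q []       disj = z≤n
count-disjoint p q (x ∷ xs) disj = ≤-trans
  (≤-reflexive (+-interchange (bit (p x)) _ (bit (q x)) _))
  (+-mono-≤ (bit-disjoint (p x) (q x) (disj (here refl)))
            (count-disjoint p q xs (disj ∘ there)))

-- Union bound by induction on the number of classes: `r zero` is absorbed into `q`, which raises
-- the count of `q` by at most one. It later bounds the loss when one edge per triangle is deleted: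
-- `p` is adjacency before the deletion, `q` adjacency after it, and `r j` the pair removed for
-- triangle `j`.
count-cover : ∀ {p q : A → Bool} xs m (r : Fin m → A → Bool) →
              (∀ x → p x ≡ true → q x ≡ true ⊎ ∃ λ j → r j x ≡ true) →
              (∀ j → count (r j) xs ≤ 1) → count p xs ≤ m + count q xs
count-cover xs zero r cover r≤1 =
  count-mono (λ x px → [ (λ qx → qx) , (λ (j , _) → contradiction j ¬Fin0) ]′ (cover x px)) xs
count-cover {p = p} {q} xs (suc m) r cover r≤1 = begin
  count p xs                                        ≤⟨ count-cover xs m (r ∘ suc) cover′ (r≤1 ∘ suc) ⟩
  m + count (λ x → r zero x ∨ q x) xs               ≤⟨ +-monoʳ-≤ m (count-∨ (r zero) q xs) ⟩
  m + (count (r zero) xs + count q xs)              ≤⟨ +-monoʳ-≤ m (+-monoˡ-≤ _ (r≤1 zero)) ⟩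
  m + suc (count q xs)                              ≡⟨ +-suc m _ ⟩
  suc m + count q xs                                ∎
  where
  open ≤-Reasoning
  cover′ : ∀ x → p x ≡ true → r zero x ∨ q x ≡ true ⊎ ∃ λ j → r (suc j) x ≡ true
  cover′ x px with r zero x in rx | cover x px
  ... | true  | _                  = inj₁ refl
  ... | false | inj₁ qx            = inj₁ qx
  ... | false | inj₂ (zero , r₀x)  = true≢false r₀x rx
  ... | false | inj₂ (suc j , rjx) = inj₂ (j , rjx)

count-unique : ∀ (p : A → Bool) {xs} → Unique xs →
               (∀ x y → p x ≡ true → p y ≡ true → x ≡ y) → count p xs ≤ 1
count-unique p []                   one = z≤n
count-unique p {x ∷ xs} (x∉xs ∷ uniq) one with p x in px
... | false = count-unique p uniq one
... | true  = ≤-reflexive (cong suc (count-none xs none))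
  where
  none : ∀ {y} → y ∈ₗ xs → p y ≡ false
  none {y} y∈xs with p y in py
  ... | false = refl
  ... | true  = contradiction (one x y px py) (All.lookup x∉xs y∈xs)

count-↭ : ∀ (p : A → Bool) {xs ys} → xs ↭ ys → count p xs ≡ count p ys
count-↭ p refl           = refl
count-↭ p (prep x xs↭ys) = cong (bit (p x) +_) (count-↭ p xs↭ys)
count-↭ p (swap {xs} x y xs↭ys) = trans (lemma (bit (p x)) (bit (p y)) (count p xs))
  (cong (λ c → bit (p y) + (bit (p x) + c)) (count-↭ p xs↭ys))
  where
  lemma : ∀ a b c → a + (b + c) ≡ b + (a + c)
  lemma = solve-∀
count-↭ p (_↭_.trans xs↭ys ys↭zs) = trans (count-↭ p xs↭ys) (count-↭ p ys↭zs)

extract : ∀ {x : A} {xs} → x ∈ₗ xs → ∃ λ ys → xs ↭ x ∷ ys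
extract {x = x} x∈xs with ∈-∃++ x∈xs
... | ys , zs , refl = ys ++ zs , shift x ys zs

∈-tail : ∀ {x y : A} {xs} → x ≢ y → x ∈ₗ y ∷ xs → x ∈ₗ xs
∈-tail x≢y (here x≡y)   = contradiction x≡y x≢y
∈-tail x≢y (there x∈xs) = x∈xs

findᵇ : ∀ (p : A → Bool) xs → count p xs ≡ 0 ⊎ ∃₂ λ x ys → p x ≡ true × xs ↭ x ∷ ys
findᵇ p []       = inj₁ refl
findᵇ p (x ∷ xs) with p x in px | findᵇ p xs
... | true  | _                        = inj₂ (x , xs , px , ↭-refl)
... | false | inj₁ none                = inj₁ none
... | false | inj₂ (y , ys , py , σ)   = inj₂ (y , x ∷ ys , py , ↭-trans (prep x σ) (swap x y ↭-refl))

-- Edges spanned by a list of vertices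

-- Each pair is charged to whichever member comes first in the list, so moving a chosen edge or
-- triangle to the front splits off its contribution by computation alone.
edgesIn : (A → A → Bool) → List A → ℕ
edgesIn r []       = 0
edgesIn r (x ∷ xs) = count (r x) xs + edgesIn r xs

-- Swapping two neighbours `x` and `y` charges their pair to the other one, and symmetry of `r`
-- makes the two charges equal.
edgesIn-↭ : ∀ (r : A → A → Bool) → (∀ x y → r x y ≡ r y x) →
            ∀ {xs ys} → xs ↭ ys → edgesIn r xs ≡ edgesIn r ys
edgesIn-↭ r r-sym refl           = refl
edgesIn-↭ r r-sym (prep x xs↭ys) = cong₂ _+_ (count-↭ (r x) xs↭ys) (edgesIn-↭ r r-sym xs↭ys)
edgesIn-↭ r r-sym (swap {xs} {ys} x y xs↭ys)
  rewrite r-sym x y | count-↭ (r x) xs↭ys | count-↭ (r y) xs↭ys | edgesIn-↭ r r-sym xs↭ys =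
  +-interchange (bit (r y x)) (count (r x) ys) (count (r y) ys) (edgesIn r ys)
edgesIn-↭ r r-sym (_↭_.trans xs↭ys ys↭zs) = trans (edgesIn-↭ r r-sym xs↭ys) (edgesIn-↭ r r-sym ys↭zs)

findEdge : ∀ (r : A → A → Bool) xs →
           edgesIn r xs ≡ 0 ⊎ ∃₂ λ x y → ∃ λ zs → r x y ≡ true × xs ↭ x ∷ y ∷ zs
findEdge r []       = inj₁ refl
findEdge r (x ∷ xs) with findᵇ (r x) xs | findEdge r xs
... | inj₂ (y , ys , rxy , σ) | _         = inj₂ (x , y , ys , rxy , prep x σ)
... | inj₁ none               | inj₁ none′ = inj₁ (cong₂ _+_ none none′)
... | inj₁ _ | inj₂ (y , z , zs , ryz , σ) =
  inj₂ (y , z , x ∷ zs , ryz ,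
    ↭-trans (prep x σ) (↭-trans (swap x y ↭-refl) (prep y (swap x z ↭-refl))))

-- Quarter squares and Mantel's theorem.

-- Since (l + 2)² = 4(l + 1) + l², the increment l + 1 is exact despite the floor. It equals the
-- largest loss when both ends of an edge are removed from a triangle-free graph on l + 2 vertices.
quarterSquare-step : ∀ l → (2 + l) ^ 2 / 4 ≡ suc l + l ^ 2 / 4
quarterSquare-step l = begin
  (2 + l) ^ 2 / 4              ≡⟨ cong (_/ 4) (expand l) ⟩
  (suc l * 4 + l ^ 2) / 4      ≡⟨ +-distrib-/-∣ˡ (l ^ 2) (divides (suc l) refl) ⟩
  suc l * 4 / 4 + l ^ 2 / 4    ≡⟨ cong (_+ l ^ 2 / 4) (m*n/n≡m (suc l) 4) ⟩
  suc l + l ^ 2 / 4            ∎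
  where
  open ≡-Reasoning
  expand : ∀ l → (2 + l) * ((2 + l) * 1) ≡ suc l * 4 + l * (l * 1)
  expand = solve-∀

quarterSquare-halves : ∀ l → l ^ 2 / 4 ≡ ⌊ l /2⌋ * ⌈ l /2⌉
quarterSquare-halves zero          = refl
quarterSquare-halves (suc zero)    = refl
quarterSquare-halves (suc (suc l)) = begin
  (2 + l) ^ 2 / 4                               ≡⟨ quarterSquare-step l ⟩
  suc l + l ^ 2 / 4                             ≡⟨ cong₂ (λ a b → suc a + b) (sym (⌊n/2⌋+⌈n/2⌉≡n l)) (quarterSquare-halves l) ⟩
  suc (⌊ l /2⌋ + ⌈ l /2⌉) + ⌊ l /2⌋ * ⌈ l /2⌉   ≡⟨ lemma ⌊ l /2⌋ ⌈ l /2⌉ ⟩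
  suc ⌊ l /2⌋ * suc ⌈ l /2⌉                     ∎
  where
  open ≡-Reasoning
  lemma : ∀ a b → suc (a + b) + a * b ≡ suc a * suc b
  lemma = solve-∀

-- Induction by removing an edge `x y`: each remaining vertex is adjacent to at most one end, so at
-- most `suc (length zs)` edges disappear. The list `zs` is a sublist of `xs` only up to
-- permutation, hence the recursion on `fuel`.
mantel : ∀ (r : A → A → Bool) → (∀ x y → r x y ≡ r y x) → ∀ fuel xs → length xs ≤ fuel →
         (∀ {x y z} → x ∈ₗ xs → y ∈ₗ xs → z ∈ₗ xs → r x y ≡ true → r x z ≡ true → ¬ r y z ≡ true) →
         edgesIn r xs ≤ length xs ^ 2 / 4
mantel r r-sym zero       []  len free = z≤n
mantel r r-sym (suc fuel) xs  len free with findEdge r xs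
... | inj₁ none = ≤-trans (≤-reflexive none) z≤n
... | inj₂ (x , y , zs , rxy , σ) = begin
  edgesIn r xs
    ≡⟨ edgesIn-↭ r r-sym σ ⟩
  (bit (r x y) + count (r x) zs) + (count (r y) zs + edgesIn r zs)
    ≡⟨ cong (λ b → (bit b + count (r x) zs) + (count (r y) zs + edgesIn r zs)) rxy ⟩
  suc (count (r x) zs) + (count (r y) zs + edgesIn r zs)
    ≡⟨ +-assoc (suc (count (r x) zs)) _ _ ⟨
  suc (count (r x) zs + count (r y) zs) + edgesIn r zs
    ≤⟨ +-mono-≤ (s≤s (≤-trans (count-disjoint (r x) (r y) zs disjoint) (count≤length _ zs)))
                (mantel r r-sym fuel zs len′ free′) ⟩
  suc (length zs) + length zs ^ 2 / 4
    ≡⟨ quarterSquare-step (length zs) ⟨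
  (2 + length zs) ^ 2 / 4
    ≡⟨ cong (λ l → l ^ 2 / 4) (↭-length σ) ⟨
  length xs ^ 2 / 4 ∎
  where
  open ≤-Reasoning
  back : ∀ {v} → v ∈ₗ x ∷ y ∷ zs → v ∈ₗ xs
  back = ∈-resp-↭ (↭-sym σ)
  disjoint : ∀ {z} → z ∈ₗ zs → r x z ≡ true → ¬ r y z ≡ true
  disjoint z∈zs = free (back (here refl)) (back (there (here refl))) (back (there (there z∈zs))) rxy
  len′ : length zs ≤ fuel
  len′ = ≤-trans (n≤1+n _) (s≤s⁻¹ (subst (_≤ suc fuel) (↭-length σ) len))
  free′ : ∀ {u v w} → u ∈ₗ zs → v ∈ₗ zs → w ∈ₗ zs → r u v ≡ true → r u w ≡ true → ¬ r v w ≡ true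
  free′ u∈ v∈ w∈ = free (back (there (there u∈))) (back (there (there v∈))) (back (there (there w∈)))

-- Only `c` is required to lie in `ws`, so the hypothesis excludes triangles inside `ws` as well as
-- those sharing one or two vertices with `x`, `y`, `z`. The former gives Mantel's bound on `ws`;
-- the latter leaves each vertex of `ws` at most one neighbour among the three.
soleTriangle-bound : ∀ (r : A → A → Bool) → (∀ x y → r x y ≡ r y x) → ∀ {x y z} ws →
  r x y ≡ true → r x z ≡ true → r y z ≡ true →
  (∀ {a b c} → c ∈ₗ ws → r a b ≡ true → r a c ≡ true → ¬ r b c ≡ true) →
  edgesIn r (x ∷ y ∷ z ∷ ws) ≤ (2 + length ws) ^ 2 / 4 + 2
soleTriangle-bound r r-sym {x} {y} {z} ws rxy rxz ryz sole rewrite rxy | rxz | ryz = begin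
  suc (suc (cx)) + (suc (cy) + (cz + e))         ≡⟨ regroup cx cy cz e ⟩
  3 + ((cx + cy) + cz) + e                       ≤⟨ +-mono-≤ (+-monoʳ-≤ 3 degrees) (mantel r r-sym _ ws ≤-refl (λ _ _ w∈ → sole w∈)) ⟩
  3 + length ws + length ws ^ 2 / 4              ≡⟨ regroup′ (length ws) _ ⟩
  suc (length ws) + length ws ^ 2 / 4 + 2        ≡⟨ cong (_+ 2) (quarterSquare-step (length ws)) ⟨
  (2 + length ws) ^ 2 / 4 + 2                    ∎
  where
  open ≤-Reasoning
  cx = count (r x) ws
  cy = count (r y) ws
  cz = count (r z) ws
  e  = edgesIn r ws
  regroup : ∀ a b c d → suc (suc a) + (suc b + (c + d)) ≡ 3 + ((a + b) + c) + d
  regroup = solve-∀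
  regroup′ : ∀ a b → 3 + a + b ≡ suc a + b + 2
  regroup′ = solve-∀
  ∨-true⁻ : ∀ {a b} → a ∨ b ≡ true → a ≡ true ⊎ b ≡ true
  ∨-true⁻ {true}  _ = inj₁ refl
  ∨-true⁻ {false} p = inj₂ p
  degrees : (cx + cy) + cz ≤ length ws
  degrees = begin
    (cx + cy) + cz
      ≤⟨ +-monoˡ-≤ cz (count-disjoint (r x) (r y) ws λ w∈ → sole w∈ rxy) ⟩
    count (λ w → r x w ∨ r y w) ws + cz
      ≤⟨ count-disjoint (λ w → r x w ∨ r y w) (r z) ws
           (λ w∈ xyw zw → [ (λ xw → sole w∈ rxz xw zw) , (λ yw → sole w∈ ryz yw zw) ]′ (∨-true⁻ xyw)) ⟩
    count (λ w → (r x w ∨ r y w) ∨ r z w) ws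
      ≤⟨ count≤length _ ws ⟩
    length ws ∎

-- Edge lists of index pairs versus edges spanned by the vertex list.

ascending : (Fin n → Fin n → Bool) → Fin n × Fin n → Bool
ascending r (i , j) = ⌊ i <? j ⌋ ∧ r i j

pairs : ∀ n → List (Fin n × Fin n)
pairs n = cartesianProduct (allFin n) (allFin n)

-- In the recursion `as` runs through the suffixes of the vertex list while `bs` stays the whole
-- list. The row hypothesis is the invariant: vertices already passed contribute nothing to the
-- remaining rows.
count-ascending-rows : ∀ (r : Fin n → Fin n → Bool) as bs → AllPairs _<ᶠ_ as →
  (∀ {a} → a ∈ₗ as → count (λ b → ascending r (a , b)) bs ≡ count (λ b → ascending r (a , b)) as) →
  count (ascending r) (cartesianProduct as bs) ≡ edgesIn r as
count-ascending-rows r []       bs _              rows = refl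
count-ascending-rows r (a ∷ as) bs (a< ∷ sorted) rows = begin
  count (ascending r) (map (a ,_) bs ++ cartesianProduct as bs)
    ≡⟨ count-++ (ascending r) (map (a ,_) bs) _ ⟩
  count (ascending r) (map (a ,_) bs) + count (ascending r) (cartesianProduct as bs)
    ≡⟨ cong₂ _+_ firstRow (count-ascending-rows r as bs sorted otherRows) ⟩
  count (r a) as + edgesIn r as ∎
  where
  open ≡-Reasoning
  firstRow : count (ascending r) (map (a ,_) bs) ≡ count (r a) as
  firstRow = begin
    count (ascending r) (map (a ,_) bs)          ≡⟨ count-map (ascending r) (a ,_) bs ⟩
    count (λ b → ascending r (a , b)) bs         ≡⟨ rows (here refl) ⟩
    bit (ascending r (a , a)) + count (λ b → ascending r (a , b)) as
      -- The diagonal entry fails the strict order, and every later entry satisfies it.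
      ≡⟨ cong₂ _+_ (cong (λ d → bit (d ∧ r a a)) (⌊⌋-false (a <? a) (<ᶠ-irrefl refl)))
                   (count-cong as (λ {b} b∈ → cong (_∧ r a b) (⌊⌋-true (a <? b) (All.lookup a< b∈)))) ⟩
    count (r a) as ∎
  otherRows : ∀ {b} → b ∈ₗ as → count (λ c → ascending r (b , c)) bs ≡ count (λ c → ascending r (b , c)) as
  otherRows {b} b∈ = trans (rows (there b∈))
    -- The vertex `a` may be dropped from row `b`, since `b < a` fails.
    (cong (λ d → bit (d ∧ r b a) + count (λ c → ascending r (b , c)) as)
          (⌊⌋-false (b <? a) (<ᶠ-asym (All.lookup a< b∈))))

count-ascending : ∀ (r : Fin n → Fin n → Bool) → count (ascending r) (pairs n) ≡ edgesIn r (allFin n)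
count-ascending {n} r =
  count-ascending-rows r (allFin n) (allFin n) (AllPairs.tabulate⁺-< λ i<j → i<j) (λ _ → refl)

numEdges≡count : ∀ (H : Graph n) → numEdges H ≡ count (ascending (adj H)) (pairs n)
numEdges≡count {n} H = length-filterᵇ (ascending (adj H)) (pairs n)

-- Copies of complete graphs

Copy : Graph n → ℕ → Set
Copy H m = Σ (Subgraph H) (complete m ≅_)

vertexOf : ∀ {H : Graph n} → Copy H m → Fin m → Fin n
vertexOf S = _≅_.to (proj₂ S)

Clique : Graph n → (Fin m → Fin n) → Set
Clique H t = ∀ {i j} → i ≢ j → adj H (t i) (t j) ≡ true

adj⇒≢ : ∀ (H : Graph n) {a b} → adj H a b ≡ true → a ≢ b
adj⇒≢ H {a} ab refl = true≢false ab (adj-irrefl H a)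

-- Adjacency is irreflexive, so distinct indices have distinct images.
clique-injective : ∀ (H : Graph n) (t : Fin m → Fin n) → Clique H t → ∀ {i j} → t i ≡ t j → i ≡ j
clique-injective H t clique {i} {j} ti≡tj with i ≟ j
... | yes i≡j = i≡j
... | no i≢j  = contradiction ti≡tj (adj⇒≢ H (clique i≢j))

copy-clique : ∀ (H : Graph n) (S : Copy H m) → Clique H (vertexOf S)
copy-clique H (S , iso) {i} {j} i≢j =
  edge⊆adj S _ _ (trans (_≅_.preserves iso i j) (cong not (⌊⌋-false (i ≟ j) i≢j)))

-- This determines a copy of a complete graph by its vertex set, which reduces comparing copies to
-- comparing vertex sets.
copy-edge : ∀ (H : Graph n) (S : Copy H m) {a b} →
            edge (proj₁ S) a b ≡ true ⇔ (a ∈ verts (proj₁ S) × b ∈ verts (proj₁ S) × a ≢ b)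
copy-edge H (S , iso) {a} {b} = mk⇔ edge⇒ ⇒edge
  where
  edge⇒ : edge S a b ≡ true → a ∈ verts S × b ∈ verts S × a ≢ b
  edge⇒ ab = edge-end S a b ab , edge-end S b a (trans (edge-sym S b a) ab) , adj⇒≢ H (edge⊆adj S a b ab)
  ⇒edge : a ∈ verts S × b ∈ verts S × a ≢ b → edge S a b ≡ true
  ⇒edge (a∈ , b∈ , a≢b) with _≅_.onto iso a a∈ | _≅_.onto iso b b∈
  ... | i , refl | j , refl =
    trans (_≅_.preserves iso i j) (cong not (⌊⌋-false (i ≟ j) λ i≡j → a≢b (cong (_≅_.to iso) i≡j)))

copies-≈ : ∀ (H : Graph n) (S T : Copy H m) →
           verts (proj₁ S) ⊆ verts (proj₁ T) → verts (proj₁ T) ⊆ verts (proj₁ S) → proj₁ S ≈ₛ proj₁ T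
copies-≈ H S T S⊆T T⊆S = ⊆-antisym S⊆T T⊆S , λ a b → ⇔→≡ (mk⇔ (transfer S T S⊆T) (transfer T S T⊆S))
  where
  open Equivalence
  transfer : ∀ (S T : Copy H _) → verts (proj₁ S) ⊆ verts (proj₁ T) → ∀ {a b} →
             edge (proj₁ S) a b ≡ true → edge (proj₁ T) a b ≡ true
  transfer S T S⊆T ab with to (copy-edge H S) ab
  ... | a∈ , b∈ , a≢b = from (copy-edge H T) (S⊆T a∈ , S⊆T b∈ , a≢b)

image : (Fin m → Fin n) → Subset n
image t = tabulateᵛ (λ v → ⌊ any? (λ i → t i ≟ v) ⌋)

image⁺ : ∀ (t : Fin m → Fin n) i → t i ∈ image t
image⁺ t i = lookup⇒[]= (t i) _ (trans (lookup∘tabulate _ (t i)) (⌊⌋-true (any? _) (i , refl)))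

image⁻ : ∀ (t : Fin m → Fin n) {v} → v ∈ image t → ∃ λ i → t i ≡ v
image⁻ t {v} v∈ = ⌊⌋-true⁻ (any? _) (trans (sym (lookup∘tabulate _ v)) ([]=⇒lookup v∈))

cliqueCopy : ∀ (H : Graph n) (t : Fin m → Fin n) → Clique H t → Copy H m
cliqueCopy H t clique = record
  { verts    = image t
  ; edge     = λ a b → ⌊ edge? a b ⌋
  ; edge-sym = λ a b → ⇔→≡ (mk⇔ (flipped a b) (flipped b a))
  ; edge⊆adj = λ a b ab → edge⇒adj (⌊⌋-true⁻ (edge? a b) ab)
  ; edge-end = λ a b ab → proj₁ (⌊⌋-true⁻ (edge? a b) ab)
  } , record
  { to        = t
  ; injective = clique-injective H t clique
  ; into      = image⁺ t
  ; onto      = λ v → image⁻ t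
  ; preserves = preserves
  }
  where
  Edge : Fin _ → Fin _ → Set
  Edge a b = a ∈ image t × b ∈ image t × a ≢ b
  edge? : ∀ a b → Dec (Edge a b)
  edge? a b = (a ∈? image t) ×-dec (b ∈? image t) ×-dec ¬? (a ≟ b)
  flipped : ∀ a b → ⌊ edge? a b ⌋ ≡ true → ⌊ edge? b a ⌋ ≡ true
  flipped a b ab with ⌊⌋-true⁻ (edge? a b) ab
  ... | a∈ , b∈ , a≢b = ⌊⌋-true (edge? b a) (b∈ , a∈ , a≢b ∘ sym)
  edge⇒adj : ∀ {a b} → Edge a b → adj H a b ≡ true
  edge⇒adj (a∈ , b∈ , a≢b) with image⁻ t a∈ | image⁻ t b∈
  ... | i , refl | j , refl = clique λ i≡j → a≢b (cong t i≡j)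
  preserves : ∀ i j → ⌊ edge? (t i) (t j) ⌋ ≡ not ⌊ i ≟ j ⌋
  preserves i j with i ≟ j
  ... | yes refl = ⌊⌋-false (edge? (t i) (t i)) λ (_ , _ , ti≢ti) → ti≢ti refl
  ... | no i≢j   = ⌊⌋-true (edge? (t i) (t j))
                     (image⁺ t i , image⁺ t j , i≢j ∘ clique-injective H t clique)

triple : A → A → A → Fin 3 → A
triple a b c zero             = a
triple a b c (suc zero)       = b
triple a b c (suc (suc zero)) = c

triple-clique : ∀ (H : Graph n) {a b c} → adj H a b ≡ true → adj H a c ≡ true → adj H b c ≡ true →
                Clique H (triple a b c)
triple-clique H ab ac bc {zero}           {zero}           i≢j = contradiction refl i≢j
triple-clique H ab ac bc {zero}           {suc zero}       i≢j = ab
triple-clique H ab ac bc {zero}           {suc (suc zero)} i≢j = ac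
triple-clique H ab ac bc {suc zero}       {zero}           i≢j = trans (adj-sym H _ _) ab
triple-clique H ab ac bc {suc zero}       {suc zero}       i≢j = contradiction refl i≢j
triple-clique H ab ac bc {suc zero}       {suc (suc zero)} i≢j = bc
triple-clique H ab ac bc {suc (suc zero)} {zero}           i≢j = trans (adj-sym H _ _) ac
triple-clique H ab ac bc {suc (suc zero)} {suc zero}       i≢j = trans (adj-sym H _ _) bc
triple-clique H ab ac bc {suc (suc zero)} {suc (suc zero)} i≢j = contradiction refl i≢j

-- The upper bound

-- The pair t i, t j is an edge meeting the complement of T whenever t leaves T, and
-- the degenerate pair i ≡ j otherwise.
outerEdge : ∀ (T : Subset n) (t : Fin 3 → Fin n) →
            ∃₂ λ i j → (t i ∈ T → i ≡ j) × (i ≡ j → ∀ l → t l ∈ T)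
outerEdge T t with any? (λ i → ¬? (t i ∈? T))
... | yes (i , ti∉T) = i , next i , (λ ti∈T → contradiction ti∈T ti∉T) , λ i≡j → contradiction i≡j (next≢ i)
  where
  next : Fin 3 → Fin 3
  next zero    = suc zero
  next (suc _) = zero
  next≢ : ∀ i → i ≢ next i
  next≢ zero    ()
  next≢ (suc _) ()
... | no inside = zero , zero , (λ _ → refl) , λ _ l → decidable-stable (t l ∈? T) λ tl∉T → inside (l , tl∉T)

Joins : Fin n → Fin n → Fin n → Fin n → Set
Joins u v a b = (a ≡ u × b ≡ v) ⊎ (a ≡ v × b ≡ u)

joins? : ∀ (u v a b : Fin n) → Dec (Joins u v a b)
joins? u v a b = (a ≟ u ×-dec b ≟ v) ⊎-dec (a ≟ v ×-dec b ≟ u)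

joins-sym : ∀ {u v a b : Fin n} → Joins u v a b → Joins u v b a
joins-sym (inj₁ (p , q)) = inj₂ (q , p)
joins-sym (inj₂ (p , q)) = inj₁ (q , p)

-- Of the two orders of a pair at most one ascends, and `pairs n` has no repetitions.
ascending-joins≤1 : ∀ (u v : Fin n) → count (ascending λ a b → ⌊ joins? u v a b ⌋) (pairs n) ≤ 1
ascending-joins≤1 {n} u v = count-unique _ (cartesianProduct⁺ (allFin⁺ n) (allFin⁺ n)) one
  where
  one : ∀ x y → ascending (λ a b → ⌊ joins? u v a b ⌋) x ≡ true →
        ascending (λ a b → ⌊ joins? u v a b ⌋) y ≡ true → x ≡ y
  one (a , b) (c , d) p q with ∧-true⁻ p | ∧-true⁻ q
  ... | a<b , jab | c<d , jcd
    with ⌊⌋-true⁻ (a <? b) a<b | ⌊⌋-true⁻ (joins? u v a b) jab | ⌊⌋-true⁻ (c <? d) c<d | ⌊⌋-true⁻ (joins? u v c d) jcd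
  ... | _   | inj₁ (refl , refl) | _   | inj₁ (refl , refl) = refl
  ... | _   | inj₂ (refl , refl) | _   | inj₂ (refl , refl) = refl
  ... | u<v | inj₁ (refl , refl) | v<u | inj₂ (refl , refl) = contradiction v<u (<ᶠ-asym u<v)
  ... | v<u | inj₂ (refl , refl) | u<v | inj₁ (refl , refl) = contradiction v<u (<ᶠ-asym u<v)

extract₃ : ∀ {x y z : A} {xs} → x ∈ₗ xs → y ∈ₗ xs → z ∈ₗ xs → x ≢ y → x ≢ z → y ≢ z →
           ∃ λ ws → xs ↭ x ∷ y ∷ z ∷ ws
extract₃ {x = x} {y} {z} x∈ y∈ z∈ x≢y x≢z y≢z with extract x∈
... | ys , σ with extract (∈-tail (x≢y ∘ sym) (∈-resp-↭ σ y∈))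
... | zs , τ with extract (∈-tail (y≢z ∘ sym) (∈-resp-↭ τ (∈-tail (x≢z ∘ sym) (∈-resp-↭ σ z∈))))
... | ws , υ = ws , ↭-trans σ (prep x (↭-trans τ (prep y υ)))

-- Deleting edges until a single triangle remains.

module _ (H : Graph n) (k : ℕ) (𝒩 : 𝒩[ H , complete 3 ]≔ suc k) where

  private
    f : Fin (suc k) → Copy H 3
    f = Inverse.to 𝒩

    -- The triangle numbered `zero` is the one to keep; `t` runs through the `k` others.
    T : Subset n
    T = verts (proj₁ (f zero))

    t₀ : Fin 3 → Fin n
    t₀ = vertexOf (f zero)

    t : Fin k → Fin 3 → Fin n
    t j = vertexOf (f (suc j))

    -- In the degenerate case of `outerEdge` the pair is a loop, so no edge of `H` is cut for that
    -- `j`.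
    Cut : Fin n → Fin n → Fin k → Set
    Cut a b j = let p , q , _ = outerEdge T (t j) in Joins (t j p) (t j q) a b

    cut? : ∀ a b j → Dec (Cut a b j)
    cut? a b j = let p , q , _ = outerEdge T (t j) in joins? (t j p) (t j q) a b

    -- Adjacency in the graph that survives the deletion.
    r : Fin n → Fin n → Bool
    r a b = adj H a b ∧ not ⌊ any? (cut? a b) ⌋

    r⁺ : ∀ {a b} → adj H a b ≡ true → (∀ j → ¬ Cut a b j) → r a b ≡ true
    r⁺ {a} {b} ab uncut = ∧-true⁺ ab (cong not (⌊⌋-false (any? (cut? a b)) λ (j , cut) → uncut j cut))

    r⁻ : ∀ {a b} → r a b ≡ true → adj H a b ≡ true × (∀ j → ¬ Cut a b j)
    r⁻ {a} {b} rab with any? (cut? a b) | ∧-true⁻ {adj H a b} rab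
    ... | no uncut | ab , _ = ab , λ j cut → uncut (j , cut)
    ... | yes _    | _ , ()

    r-sym′ : ∀ a b → r a b ≡ true → r b a ≡ true
    r-sym′ a b rab = let ab , uncut = r⁻ rab in
      r⁺ (trans (adj-sym H b a) ab) λ j cut → uncut j (joins-sym cut)

    r-sym : ∀ a b → r a b ≡ r b a
    r-sym a b = ⇔→≡ (mk⇔ (r-sym′ a b) (r-sym′ b a))

    -- Every edge of `H` survives or is the cut pair of some `j`, and each `j` accounts for at most
    -- one ascending pair.
    numEdges≤ : numEdges H ≤ k + edgesIn r (allFin n)
    numEdges≤ = begin
      numEdges H                                 ≡⟨ numEdges≡count H ⟩
      count (ascending (adj H)) (pairs n)        ≤⟨ count-cover (pairs n) k
                                                      (λ j → ascending λ a b → ⌊ cut? a b j ⌋) cover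
                                                      (λ j → let p , q , _ = outerEdge T (t j) in
                                                             ascending-joins≤1 (t j p) (t j q)) ⟩
      k + count (ascending r) (pairs n)          ≡⟨ cong (k +_) (count-ascending r) ⟩
      k + edgesIn r (allFin n)                   ∎
      where
      open ≤-Reasoning
      cover : ∀ x → ascending (adj H) x ≡ true →
              ascending r x ≡ true ⊎ ∃ λ j → ascending (λ a b → ⌊ cut? a b j ⌋) x ≡ true
      cover (a , b) p with ∧-true⁻ p | any? (cut? a b)
      ... | a<b , ab | yes (j , cut) = inj₂ (j , ∧-true⁺ a<b (⌊⌋-true (cut? a b j) cut))
      ... | a<b , ab | no uncut      = inj₁ (∧-true⁺ a<b (∧-true⁺ ab refl))

    -- A nondegenerate cut pair has an end outside `T`, and a degenerate one is a loop; neither is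
    -- an edge between vertices of `T`.
    r-inside : ∀ {a b} → a ∈ T → b ∈ T → adj H a b ≡ true → r a b ≡ true
    r-inside a∈T b∈T ab = r⁺ ab uncut
      where
      uncut : ∀ j → ¬ Cut _ _ j
      uncut j cut with outerEdge T (t j)
      uncut j (inj₁ (refl , refl)) | p , q , degenerate , _ = adj⇒≢ H ab (cong (t j) (degenerate a∈T))
      uncut j (inj₂ (refl , refl)) | p , q , degenerate , _ = adj⇒≢ H ab (cong (t j) (sym (degenerate b∈T)))

    -- Such a triangle is one of `H`, so it has a number. Number `zero` would put `c` in `T`. For
    -- number `suc j`, a degenerate cut means that the whole triangle, `c` included, lies in `T`;
    -- otherwise the cut pair is one of its sides, yet all its sides survive.
    r-sole : ∀ {a b c} → c ∉ T → r a b ≡ true → r a c ≡ true → ¬ r b c ≡ true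
    r-sole {a} {b} {c} c∉T rab rac rbc = excluded (Inverse.from 𝒩 S) (Inverse.inverseˡ 𝒩 refl)
      where
      clique : Clique H (triple a b c)
      clique = triple-clique H (proj₁ (r⁻ rab)) (proj₁ (r⁻ rac)) (proj₁ (r⁻ rbc))
      S : Copy H 3
      S = cliqueCopy H (triple a b c) clique
      -- Packaging `r` as a graph lets `triple-clique` supply its adjacencies in every order of `a`,
      -- `b`, `c`.
      r-graph : Graph n
      r-graph = record { adj = r ; adj-sym = r-sym ; adj-irrefl = λ i → irrefl i }
        where
        irrefl : ∀ i → r i i ≡ false
        irrefl i rewrite adj-irrefl H i = refl
      c∈S : c ∈ verts (proj₁ S)
      c∈S = image⁺ (triple a b c) (suc (suc zero))
      excluded : ∀ i → proj₁ (f i) ≈ₛ proj₁ S → ⊥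
      excluded zero    (verts≡ , _) = contradiction (subst (c ∈_) (sym verts≡) c∈S) c∉T
      excluded (suc j) (verts≡ , _) with outerEdge T (t j) in eq
      ... | p , q , _ , inside with p ≟ q
      ...   | yes p≡q = contradiction c∈T c∉T
        where
        c∈T : c ∈ T
        c∈T with _≅_.onto (proj₂ (f (suc j))) c (subst (c ∈_) (sym verts≡) c∈S)
        ... | l , refl = inside p≡q l
      ...   | no p≢q  = contradiction cut (proj₂ (r⁻ r-pq) j)
        where
        place : ∀ l → ∃ λ i → triple a b c i ≡ t j l
        place l = image⁻ (triple a b c) (subst (t j l ∈_) verts≡ (_≅_.into (proj₂ (f (suc j))) l))
        -- The ends of the cut pair are distinct vertices of the triangle, hence sit at different
        -- places among `a`, `b`, `c`.
        r-pq : r (t j p) (t j q) ≡ true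
        r-pq with place p | place q
        ... | i , i↦ | i′ , i′↦ = subst₂ (λ u v → r u v ≡ true) i↦ i′↦
          (triple-clique r-graph rab rac rbc λ i≡i′ → p≢q
            (clique-injective H (t j) (copy-clique H (f (suc j)))
              (trans (sym i↦) (trans (cong (triple a b c) i≡i′) i′↦))))
        cut : Cut (t j p) (t j q) j
        cut rewrite eq = inj₁ (refl , refl)

  -- The vertices of `T` are moved to the front of the vertex list, where the bound for a sole
  -- triangle applies. There are `suc k` triangles and `k` deletions, so the constant k + 2 reads (k
  -- + 1) + 1.
  upperBound : numEdges H ≤ (n ∸ 1) ^ 2 / 4 + suc k + 1
  upperBound with extract₃ (∈-allFin (t₀ zero)) (∈-allFin (t₀ (suc zero))) (∈-allFin (t₀ (suc (suc zero))))
                   (distinct λ ()) (distinct λ ()) (distinct λ ())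
    where
    distinct : ∀ {i j} → i ≢ j → t₀ i ≢ t₀ j
    distinct i≢j = adj⇒≢ H (copy-clique H (f zero) i≢j)
  ... | ws , σ = begin
    numEdges H                                      ≤⟨ numEdges≤ ⟩
    k + edgesIn r (allFin n)                        ≡⟨ cong (k +_) (edgesIn-↭ r r-sym σ) ⟩
    k + edgesIn r (_ ∷ _ ∷ _ ∷ ws)                  ≤⟨ +-monoʳ-≤ k (soleTriangle-bound r r-sym ws
                                                         (kept λ ()) (kept λ ()) (kept λ ()) λ w∈ → r-sole (outside w∈)) ⟩
    k + ((2 + length ws) ^ 2 / 4 + 2)               ≡⟨ cong (λ l → k + (l ^ 2 / 4 + 2)) size ⟨
    k + ((n ∸ 1) ^ 2 / 4 + 2)                       ≡⟨ regroup k _ ⟩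
    (n ∸ 1) ^ 2 / 4 + suc k + 1                     ∎
    where
    open ≤-Reasoning
    regroup : ∀ k e → k + (e + 2) ≡ e + suc k + 1
    regroup = solve-∀
    size : n ∸ 1 ≡ 2 + length ws
    size = cong (_∸ 1) (trans (sym (length-tabulate {n = n} (λ i → i))) (↭-length σ))
    t₀∈T : ∀ i → t₀ i ∈ T
    t₀∈T = _≅_.into (proj₂ (f zero))
    kept : ∀ {i j} → i ≢ j → r (t₀ i) (t₀ j) ≡ true
    kept {i} {j} i≢j = r-inside (t₀∈T i) (t₀∈T j) (copy-clique H (f zero) i≢j)
    outside : ∀ {w} → w ∈ₗ ws → w ∉ T
    -- `σ` rearranges a list without repetitions, so no vertex of `T` recurs in `ws`.
    outside {w} w∈ w∈T with _≅_.onto (proj₂ (f zero)) w w∈T | ↭ₛ.Unique-resp-↭ (setoid (Fin n)) (↭⇒↭ₛ σ) (allFin⁺ n)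
    ... | zero           , refl | x∉ ∷ _          = All.lookup x∉ (there (there w∈)) refl
    ... | suc zero       , refl | _ ∷ y∉ ∷ _      = All.lookup y∉ (there w∈) refl
    ... | suc (suc zero) , refl | _ ∷ _ ∷ z∉ ∷ _  = All.lookup z∉ w∈ refl

-- The extremal graph

edgesIn-tabulate : ∀ (r : A → A → Bool) (f : Fin n → A) →
                   edgesIn r (tabulate f) ≡ edgesIn (λ i j → r (f i) (f j)) (allFin n)
edgesIn-tabulate {n = zero}  r f = refl
edgesIn-tabulate {n = suc n} r f = cong₂ _+_
  (trans (count-tabulate (r (f zero)) (f ∘ suc)) (sym (count-tabulate (λ i → r (f zero) (f i)) suc)))
  (trans (edgesIn-tabulate r (f ∘ suc)) (sym (edgesIn-tabulate (λ i j → r (f i) (f j)) suc)))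

-- The head is joined to exactly the opposite class of the tail, so it raises one factor of the
-- product by one.
edgesIn-bipartite : ∀ (c : A → Bool) xs →
                    edgesIn (λ x y → c x xor c y) xs ≡ count c xs * count (not ∘ c) xs
edgesIn-bipartite c []       = refl
edgesIn-bipartite c (x ∷ xs) with c x
... | true  = cong (count (not ∘ c) xs +_) (edgesIn-bipartite c xs)
... | false = trans (cong (count c xs +_) (edgesIn-bipartite c xs)) (sym (*-suc (count c xs) _))

count-complement : ∀ (c : A → Bool) xs → count c xs + count (not ∘ c) xs ≡ length xs
count-complement c []       = refl
count-complement c (x ∷ xs) with c x
... | true  = cong suc (count-complement c xs)
... | false = trans (+-suc _ _) (cong suc (count-complement c xs))

below : ℕ → Fin n → Bool
below c i = toℕ i <ᵇ c

below⁻ : ∀ {c} (i : Fin n) → below c i ≡ true → toℕ i < c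
below⁻ i i<c = <ᵇ⇒< (toℕ i) _ (Equivalence.from T-≡ i<c)

below⁺ : ∀ {c} (i : Fin n) → toℕ i < c → below c i ≡ true
below⁺ i i<c = Equivalence.to T-≡ (<⇒<ᵇ i<c)

count-below : ∀ {c} → c ≤ n → count (below c) (allFin n) ≡ c
count-below {n = n}     {zero}  c≤n       = count-none (allFin n) (λ _ → refl)
count-below {n = suc n} {suc c} (s≤s c≤n) = cong suc (trans (count-tabulate (below {suc n} (suc c)) suc) (count-below c≤n))

-- Two of any three Booleans agree, so a complete bipartite graph has no triangle.
xor-odd-cycle : ∀ x y z → x xor y ≡ true → x xor z ≡ true → ¬ y xor z ≡ true
xor-odd-cycle true  false false _ _ ()
xor-odd-cycle false true  true  _ _ ()

both-xor : ∀ {x y} → x ≡ true → y ≡ true → ¬ x xor y ≡ true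
both-xor refl refl ()

module Extremal (k c M : ℕ) (k≤c : k ≤ c) (c≤M : c ≤ M) where

  -- Vertices 2 + i form a complete bipartite graph between i < c and i ≥ c; vertex 1
  -- joins the second part, and vertex 0 is attached to 1 and to k vertices of the first.
  link : Fin (2 + M) → Fin (2 + M) → Bool
  link zero          zero          = false
  link zero          (suc zero)    = true
  link zero          (suc (suc j)) = below k j
  link (suc zero)    zero          = true
  link (suc zero)    (suc zero)    = false
  link (suc zero)    (suc (suc j)) = below c j
  link (suc (suc i)) zero          = below k i
  link (suc (suc i)) (suc zero)    = below c i
  link (suc (suc i)) (suc (suc j)) = below c i xor below c j

  extremal : Graph (2 + M)
  extremal = record { adj = link ; adj-sym = link-sym ; adj-irrefl = link-irrefl }
    where
    link-sym : ∀ i j → link i j ≡ link j i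
    link-sym zero          zero          = refl
    link-sym zero          (suc zero)    = refl
    link-sym zero          (suc (suc j)) = refl
    link-sym (suc zero)    zero          = refl
    link-sym (suc zero)    (suc zero)    = refl
    link-sym (suc zero)    (suc (suc j)) = refl
    link-sym (suc (suc i)) zero          = refl
    link-sym (suc (suc i)) (suc zero)    = refl
    link-sym (suc (suc i)) (suc (suc j)) = xor-comm (below c i) (below c j)
    link-irrefl : ∀ i → link i i ≡ false
    link-irrefl zero          = refl
    link-irrefl (suc zero)    = refl
    link-irrefl (suc (suc i)) = xor-same (below c i)

  numEdges-extremal : numEdges extremal ≡ c * suc (M ∸ c) + k + 1
  numEdges-extremal = begin
    numEdges extremal
      ≡⟨ trans (numEdges≡count extremal) (count-ascending link) ⟩
    suc (count (link zero) rest) + (count (link (suc zero)) rest + edgesIn link rest)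
      ≡⟨ cong₂ (λ a b → suc a + b) (trans (count-tabulate (link zero) ss) (count-below (≤-trans k≤c c≤M)))
               (cong₂ _+_ (trans (count-tabulate (link (suc zero)) ss) (count-below c≤M))
                          (trans (edgesIn-tabulate link ss) bipartite)) ⟩
    -- Vertex 0 contributes its full degree `suc k`, vertex 1 its `c` remaining edges, and the other
    -- vertices span `c * (M ∸ c)`.
    suc k + (c + c * (M ∸ c))
      ≡⟨ regroup k c (M ∸ c) ⟩
    c * suc (M ∸ c) + k + 1 ∎
    where
    open ≡-Reasoning
    ss : Fin M → Fin (2 + M)
    ss i = suc (suc i)
    rest : List (Fin (2 + M))
    rest = tabulate ss
    regroup : ∀ k c d → suc k + (c + c * d) ≡ c * suc d + k + 1
    regroup = solve-∀
    above : count (not ∘ below c) (allFin M) ≡ M ∸ c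
    above = begin
      count (not ∘ below c) (allFin M)           ≡⟨ m+n∸m≡n c _ ⟨
      c + count (not ∘ below c) (allFin M) ∸ c   ≡⟨ cong (λ b → b + count (not ∘ below c) (allFin M) ∸ c) (count-below c≤M) ⟨
      count (below c) (allFin M) + count (not ∘ below c) (allFin M) ∸ c
                                                 ≡⟨ cong (_∸ c) (count-complement (below c) (allFin M)) ⟩
      length (allFin M) ∸ c                      ≡⟨ cong (_∸ c) (length-tabulate {n = M} (λ i → i)) ⟩
      M ∸ c                                      ∎
    bipartite : edgesIn (λ i j → below c i xor below c j) (allFin M) ≡ c * (M ∸ c)
    bipartite = trans (edgesIn-bipartite (below c) (allFin M)) (cong₂ _*_ (count-below c≤M) above)

  -- The triangles of the extremal graph.

  page : Fin k → Fin (2 + M)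
  page j = suc (suc (inject≤ j (≤-trans k≤c c≤M)))

  -- The triangles form a book: `k` pages sharing the edge between 0 and 1 as spine.
  book : Fin k → Fin 3 → Fin (2 + M)
  book j = triple zero (suc zero) (page j)

  below-c : ∀ (i : Fin M) → below k i ≡ true → below c i ≡ true
  below-c i i<k = below⁺ i (<-≤-trans (below⁻ i i<k) k≤c)

  book-clique : ∀ j → Clique extremal (book j)
  book-clique j = triple-clique extremal refl 0~page (below-c _ 0~page)
    where
    0~page : below k (inject≤ j (≤-trans k≤c c≤M)) ≡ true
    0~page = below⁺ (inject≤ j _) (subst (_< k) (sym (toℕ-inject≤ j _)) (toℕ<n j))

  findPage : ∀ i → below k i ≡ true → ∃ λ j → suc (suc i) ≡ page j
  findPage i i<k = fromℕ< (below⁻ i i<k) ,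
    cong (λ l → suc (suc l)) (toℕ-injective (trans (sym (toℕ-fromℕ< _)) (sym (toℕ-inject≤ _ _))))

  -- Without vertex 0 the graph is bipartite, so every triangle contains 0. The neighbours of 0
  -- other than 1 lie in one part because `k ≤ c`, so the triangle contains 1 too, and its third
  -- vertex is a page. An isomorphism may list the vertices in any order, whence the permutation.
  triangle-book : ∀ u v w → link u v ≡ true → link u w ≡ true → link v w ≡ true →
                  ∃ λ j → u ∷ v ∷ w ∷ [] ↭ zero ∷ suc zero ∷ page j ∷ []
  triangle-book zero zero w () _ _
  triangle-book zero (suc zero) zero _ () _
  triangle-book zero (suc zero) (suc zero) _ _ ()
  triangle-book zero (suc zero) (suc (suc i)) _ 0i _ with findPage i 0i
  ... | j , refl = j , ↭-refl
  triangle-book zero (suc (suc i)) zero _ () _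
  triangle-book zero (suc (suc i)) (suc zero) 0i _ _ with findPage i 0i
  ... | j , refl = j , prep zero (swap _ _ ↭-refl)
  triangle-book zero (suc (suc i)) (suc (suc j)) 0i 0j ij = contradiction ij (both-xor (below-c i 0i) (below-c j 0j))
  triangle-book (suc zero) zero zero _ _ ()
  triangle-book (suc zero) zero (suc zero) _ () _
  triangle-book (suc zero) zero (suc (suc i)) _ _ 0i with findPage i 0i
  ... | j , refl = j , swap _ _ ↭-refl
  triangle-book (suc zero) (suc zero) w () _ _
  triangle-book (suc zero) (suc (suc i)) zero _ _ 0i with findPage i 0i
  ... | j , refl = j , ↭-trans (prep (suc zero) (swap _ _ ↭-refl)) (swap _ _ ↭-refl)
  triangle-book (suc zero) (suc (suc i)) (suc zero) _ () _
  triangle-book (suc zero) (suc (suc i)) (suc (suc j)) 1i 1j ij = contradiction ij (both-xor 1i 1j)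
  triangle-book (suc (suc i)) zero zero _ _ ()
  triangle-book (suc (suc i)) zero (suc zero) 0i _ _ with findPage i 0i
  ... | j , refl = j , ↭-trans (swap _ _ ↭-refl) (prep zero (swap _ _ ↭-refl))
  triangle-book (suc (suc i)) zero (suc (suc j)) 0i ij 0j = contradiction ij (both-xor (below-c i 0i) (below-c j 0j))
  triangle-book (suc (suc i)) (suc zero) zero _ 0i _ with findPage i 0i
  ... | j , refl = j , ↭-trans (swap _ _ ↭-refl)
                         (↭-trans (prep (suc zero) (swap _ _ ↭-refl)) (swap _ _ ↭-refl))
  triangle-book (suc (suc i)) (suc zero) (suc zero) _ _ ()
  triangle-book (suc (suc i)) (suc zero) (suc (suc j)) 1i ij 1j = contradiction ij (both-xor 1i 1j)
  triangle-book (suc (suc i)) (suc (suc j)) zero ij 0i 0j = contradiction ij (both-xor (below-c i 0i) (below-c j 0j))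
  triangle-book (suc (suc i)) (suc (suc j)) (suc zero) ij 1i 1j = contradiction ij (both-xor 1i 1j)
  triangle-book (suc (suc i)) (suc (suc j)) (suc (suc l)) ij il jl =
    contradiction jl (xor-odd-cycle (below c i) (below c j) (below c l) ij il)

  bookCopy : Fin k → Copy extremal 3
  bookCopy j = cliqueCopy extremal (book j) (book-clique j)

  -- `page i` occurs in the triangle of `j` and is neither 0 nor 1, so it is `page j`.
  bookCopy-injective : ∀ {i j} → proj₁ (bookCopy i) ≈ₛ proj₁ (bookCopy j) → i ≡ j
  bookCopy-injective {i} {j} (verts≡ , _)
    with image⁻ (book j) (subst (page i ∈_) verts≡ (image⁺ (book i) (suc (suc zero))))
  ... | suc (suc zero) , page≡ = sym (inject≤-injective _ _ _ _ (suc-injective (suc-injective page≡)))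

  bookCopy-surjective : ∀ (S : Copy extremal 3) → ∃ λ j → proj₁ (bookCopy j) ≈ₛ proj₁ S
  bookCopy-surjective S = proj₁ found , copies-≈ extremal (bookCopy (proj₁ found)) S
    (λ {v} v∈ → case image⁻ (book j) v∈ of λ
      { (i , refl) → case ∈-tabulate⁻ (∈-resp-↭ (↭-sym σ) (∈-tabulate⁺ {f = book j} i)) of λ
        { (l , v≡) → subst (_∈ verts (proj₁ S)) (sym v≡) (into l) } })
    (λ {v} v∈ → case onto v v∈ of λ
      { (l , refl) → case ∈-tabulate⁻ (∈-resp-↭ σ (∈-tabulate⁺ {f = to} l)) of λ
        { (i , v≡) → subst (_∈ image (book j)) (sym v≡) (image⁺ (book j) i) } })
    where
    open _≅_ (proj₂ S)
    clique : Clique extremal to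
    clique = copy-clique extremal S
    found : ∃ λ j → tabulate to ↭ tabulate (book j)
    found = triangle-book (to zero) (to (suc zero)) (to (suc (suc zero))) (clique λ ()) (clique λ ()) (clique λ ())
    j = proj₁ found
    σ = proj₂ found

  𝒩-extremal : 𝒩[ extremal , complete 3 ]≔ k
  𝒩-extremal = Bijection⇒Inverse record
    { to        = bookCopy
    ; cong      = λ { refl → refl , λ _ _ → refl }
    ; bijective = (λ {i} {j} → bookCopy-injective {i} {j}) ,
                  λ S → let j , j≈S = bookCopy-surjective S in j , λ { refl → j≈S }
    }

-- The two bounds combined.

theorem1p5 : ∀ (k : ℕ) → k > 0 →
    ∃ λ (n₀ : ℕ) → ∀ (n : ℕ) → n₀ ≤ n →
    exa[ k ]⟨ n , complete 3 ⟩≔ ((n ∸ 1) ^ 2 / 4 + k + 1)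
-- With M = n - 2 the first part has ⌈M/2⌉ vertices and must contain `K` neighbours of vertex 0; M ≥
-- 2K guarantees this.
theorem1p5 (suc k) _ = 2 + (K + K) , bounds
  where
  K = suc k
  bounds : ∀ n → 2 + (K + K) ≤ n → exa[ K ]⟨ n , complete 3 ⟩≔ ((n ∸ 1) ^ 2 / 4 + K + 1)
  bounds (suc (suc M)) (s≤s (s≤s 2K≤M)) = (extremal , 𝒩-extremal , size) , λ H → upperBound H k
    where
    open Extremal K ⌈ M /2⌉ M
      (≤-trans (≤-reflexive (n≡⌈n+n/2⌉ K)) (⌈n/2⌉-mono 2K≤M)) (⌈n/2⌉≤n M)
    size : numEdges extremal ≡ suc M ^ 2 / 4 + K + 1
    size = trans numEdges-extremal (cong (λ e → e + K + 1) (begin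
      ⌈ M /2⌉ * suc (M ∸ ⌈ M /2⌉)  ≡⟨ cong (λ h → ⌈ M /2⌉ * suc h) (begin
          M ∸ ⌈ M /2⌉                      ≡⟨ cong (_∸ ⌈ M /2⌉) (⌊n/2⌋+⌈n/2⌉≡n M) ⟨
          ⌊ M /2⌋ + ⌈ M /2⌉ ∸ ⌈ M /2⌉      ≡⟨ m+n∸n≡m ⌊ M /2⌋ ⌈ M /2⌉ ⟩
          ⌊ M /2⌋                          ∎) ⟩
      -- The halves of `suc M` compute to `⌈ M /2⌉` and `suc ⌊ M /2⌋`.
      ⌈ M /2⌉ * suc ⌊ M /2⌋        ≡⟨ quarterSquare-halves (suc M) ⟨
      suc M ^ 2 / 4                ∎))
      where open ≡-Reasoning
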